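{- Let $p>q\geq 2$ be relatively prime integers with $p\geq 2q-1$, and let $k>0$ be an integer. Then there exists a finite union of intervals $I\subseteq[0,1)$ of total length at most $(q/p)^k$ such that $Z_{p/q}(I)\neq\emptyset$.
   Context: For $x\in\mathbb{R}$, $\{x\}=x-\lfloor x\rfloor$ denotes the fractional part. For relatively prime integers $p>q>1$ and $S\subseteq[0,1)$, $Z_{p/q}(S)=\{\xi>0 \mid \{\xi (p/q)^i\}\in S \text{ for every } i\in\mathbb{N}\}$, where $\mathbb{N}=\{0,1,2,\dots\}$. -}

module Defs where

import Algebra.Definitions.RawSemiring
open import Data.Bool using (Bool; if_then_else_)
open import Data.Integer as ℤ using (ℤ; +_)
open import Data.List using (List; foldr; map)
open import Data.List.Relation.Unary.Any using (Any)
open import Data.Nat as ℕ using (ℕ; NonZero)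
import Data.Nat.Properties as ℕₚ
open import Data.Product using (_×_; _,_; ∃-syntax)
open import Data.Rational as ℚ using (ℚ; 0ℚ; 1ℚ; ½; ∣_∣)
import Data.Rational.Properties as ℚₚ
open import Data.Rational.Solver using (module +-*-Solver)
open import Level using (0ℓ)
open import Relation.Binary.PropositionalEquality using (_≡_; refl; sym; trans; cong; subst)
open import Relation.Unary using (Pred; _∈_)

open Algebra.Definitions.RawSemiring ℚ.+-*-rawSemiring public using () renaming (_^_ to _^ℚ_)

-- A real number is represented by a Cauchy sequence of rationals; x and y
-- represent the same real exactly when x ≤ y and y ≤ x in the order below.

IsCauchy : (ℕ → ℚ) → Set
IsCauchy x = ∀ ε → 0ℚ ℚ.< ε →
  ∃[ N ] (∀ m n → N ℕ.≤ m → N ℕ.≤ n → ∣ x m ℚ.- x n ∣ ℚ.< ε)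

record ℝ : Set where
  constructor mkℝ
  field
    seq    : ℕ → ℚ
    cauchy : IsCauchy seq

open ℝ public

private
  0<½* : ∀ ε → 0ℚ ℚ.< ε → 0ℚ ℚ.< ½ ℚ.* ε
  0<½* ε 0<ε = subst (ℚ._< ½ ℚ.* ε) (ℚₚ.*-zeroʳ ½) (ℚₚ.*-monoʳ-<-pos ½ 0<ε)

  const-cauchy : ∀ r → IsCauchy (λ _ → r)
  const-cauchy r ε 0<ε =
    0 , λ _ _ _ _ → subst (λ d → ∣ d ∣ ℚ.< ε) (sym (ℚₚ.+-inverseʳ r)) 0<ε

  +-cauchy : ∀ x y → IsCauchy x → IsCauchy y → IsCauchy (λ n → x n ℚ.+ y n)
  +-cauchy x y cx cy ε 0<ε
    with cx (½ ℚ.* ε) (0<½* ε 0<ε) | cy (½ ℚ.* ε) (0<½* ε 0<ε)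
  ... | M , hx | N , hy = M ℕ.⊔ N , λ m n p q →
    let open ℚₚ.≤-Reasoning in begin-strict
      ∣ (x m ℚ.+ y m) ℚ.- (x n ℚ.+ y n) ∣
        ≡⟨ cong ∣_∣ (regroup (x m) (y m) (x n) (y n)) ⟩
      ∣ (x m ℚ.- x n) ℚ.+ (y m ℚ.- y n) ∣
        ≤⟨ ℚₚ.∣p+q∣≤∣p∣+∣q∣ (x m ℚ.- x n) (y m ℚ.- y n) ⟩
      ∣ x m ℚ.- x n ∣ ℚ.+ ∣ y m ℚ.- y n ∣
        <⟨ ℚₚ.+-mono-< (hx m n (ℕₚ.m⊔n≤o⇒m≤o M N p) (ℕₚ.m⊔n≤o⇒m≤o M N q))
                       (hy m n (ℕₚ.m⊔n≤o⇒n≤o M N p) (ℕₚ.m⊔n≤o⇒n≤o M N q)) ⟩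
      ½ ℚ.* ε ℚ.+ ½ ℚ.* ε
        ≡⟨ trans (sym (ℚₚ.*-distribʳ-+ ε ½ ½)) (ℚₚ.*-identityˡ ε) ⟩
      ε ∎
    where
    regroup : ∀ a b c d → (a ℚ.+ b) ℚ.- (c ℚ.+ d) ≡ (a ℚ.- c) ℚ.+ (b ℚ.- d)
    regroup = solve 4 (λ a b c d → (a :+ b) :- (c :+ d) := (a :- c) :+ (b :- d)) refl
      where open +-*-Solver

  ·-cauchy : ∀ r x → IsCauchy x → IsCauchy (λ n → r ℚ.* x n)
  ·-cauchy r x cx ε 0<ε = scaled (cx δ 0<δ)
    where
    s : ℚ
    s = ∣ r ∣ ℚ.+ 1ℚ

    instance
      s-pos : ℚ.Positive s
      s-pos = ℚₚ.nonNeg+pos⇒pos ∣ r ∣ {{ℚₚ.∣-∣-nonNeg r}} 1ℚ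

      s-nonZero : ℚ.NonZero s
      s-nonZero = ℚₚ.pos⇒nonZero s

    δ : ℚ
    δ = ℚ.1/ s ℚ.* ε

    0<δ : 0ℚ ℚ.< δ
    0<δ = subst (ℚ._< δ) (ℚₚ.*-zeroʳ (ℚ.1/ s))
            (ℚₚ.*-monoʳ-<-pos (ℚ.1/ s) {{ℚₚ.1/pos⇒pos s}} 0<ε)

    factor : ∀ a b c → a ℚ.* b ℚ.- a ℚ.* c ≡ a ℚ.* (b ℚ.- c)
    factor = solve 3 (λ a b c → a :* b :- a :* c := a :* (b :- c)) refl
      where open +-*-Solver

    ∣r∣≤s : ∣ r ∣ ℚ.≤ s
    ∣r∣≤s = subst (ℚ._≤ s) (ℚₚ.+-identityʳ ∣ r ∣)
              (ℚₚ.+-monoʳ-≤ ∣ r ∣ (ℚₚ.nonNegative⁻¹ 1ℚ))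

    scaled : ∃[ N ] (∀ m n → N ℕ.≤ m → N ℕ.≤ n → ∣ x m ℚ.- x n ∣ ℚ.< δ) →
             ∃[ N ] (∀ m n → N ℕ.≤ m → N ℕ.≤ n → ∣ r ℚ.* x m ℚ.- r ℚ.* x n ∣ ℚ.< ε)
    scaled (N , h) = N , λ m n p q →
      let open ℚₚ.≤-Reasoning in begin-strict
        ∣ r ℚ.* x m ℚ.- r ℚ.* x n ∣
          ≡⟨ cong ∣_∣ (factor r (x m) (x n)) ⟩
        ∣ r ℚ.* (x m ℚ.- x n) ∣
          ≡⟨ ℚₚ.∣p*q∣≡∣p∣*∣q∣ r (x m ℚ.- x n) ⟩
        ∣ r ∣ ℚ.* ∣ x m ℚ.- x n ∣
          ≤⟨ ℚₚ.*-monoʳ-≤-nonNeg ∣ x m ℚ.- x n ∣ {{ℚₚ.∣-∣-nonNeg (x m ℚ.- x n)}} ∣r∣≤s ⟩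
        s ℚ.* ∣ x m ℚ.- x n ∣
          <⟨ ℚₚ.*-monoʳ-<-pos s (h m n p q) ⟩
        s ℚ.* (ℚ.1/ s ℚ.* ε)
          ≡⟨ sym (ℚₚ.*-assoc s (ℚ.1/ s) ε) ⟩
        (s ℚ.* ℚ.1/ s) ℚ.* ε
          ≡⟨ cong (ℚ._* ε) (ℚₚ.*-inverseʳ s) ⟩
        1ℚ ℚ.* ε
          ≡⟨ ℚₚ.*-identityˡ ε ⟩
        ε ∎

infix  4 _≤_ _<_
infixl 6 _+_ _-_
infixr 7 _·_

fromℚ : ℚ → ℝ
fromℚ r = mkℝ (λ _ → r) (const-cauchy r)

fromℤ : ℤ → ℝ
fromℤ n = fromℚ (n ℚ./ 1)

0ℝ 1ℝ : ℝ
0ℝ = fromℚ 0ℚ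
1ℝ = fromℚ 1ℚ

_+_ : ℝ → ℝ → ℝ
x + y = mkℝ (λ n → seq x n ℚ.+ seq y n) (+-cauchy (seq x) (seq y) (cauchy x) (cauchy y))

-- Only products of a real with a rational occur in the theorem.
_·_ : ℚ → ℝ → ℝ
r · x = mkℝ (λ n → r ℚ.* seq x n) (·-cauchy r (seq x) (cauchy x))

_-_ : ℝ → ℝ → ℝ
x - y = x + (ℚ.- 1ℚ) · y

_<_ : ℝ → ℝ → Set
x < y = ∃[ ε ] (0ℚ ℚ.< ε × ∃[ N ] (∀ n → N ℕ.≤ n → seq x n ℚ.+ ε ℚ.≤ seq y n))

_≤_ : ℝ → ℝ → Set
x ≤ y = ∀ ε → 0ℚ ℚ.< ε → ∃[ N ] (∀ n → N ℕ.≤ n → seq x n ℚ.≤ seq y n ℚ.+ ε)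

-- The floor is a relation because it is not a computable function on ℝ.
IsFloor : ℝ → ℤ → Set
IsFloor x n = fromℤ n ≤ x × x < fromℤ (n ℤ.+ + 1)

-- The fractional part {x} = x - ⌊x⌋ lies in S.
FracIn : Pred ℝ 0ℓ → ℝ → Set
FracIn S x = ∃[ n ] (IsFloor x n × x - fromℤ n ∈ S)

[0,1⟩ : Pred ℝ 0ℓ
[0,1⟩ x = 0ℝ ≤ x × x < 1ℝ

Z : (p q : ℕ) .{{_ : NonZero q}} → Pred ℝ 0ℓ → Pred ℝ 0ℓ
Z p q S ξ = 0ℝ < ξ × (∀ (i : ℕ) → FracIn S (((+ p ℚ./ q) ^ℚ i) · ξ))

record Interval : Set where
  field
    lower upper  : ℝ
    lower≤upper  : lower ≤ upper
    lower-closed : Bool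
    upper-closed : Bool

open Interval public

⟦_⟧ : Interval → Pred ℝ 0ℓ
⟦ J ⟧ x = (if lower-closed J then lower J ≤ x else lower J < x)
        × (if upper-closed J then x ≤ upper J else x < upper J)

⋃ : List Interval → Pred ℝ 0ℓ
⋃ Js x = Any (λ J → x ∈ ⟦ J ⟧) Js

length : Interval → ℝ
length J = upper J - lower J

-- Overlaps are counted with multiplicity, so this bounds the Lebesgue measure
-- of ⋃ Js from above, with equality when the intervals are disjoint.
totalLength : List Interval → ℝ
totalLength Js = foldr _+_ 0ℝ (map length Js)

{-# OPTIONS --safe #-}
module Submission where

-- Let T n = ⌈pn/q⌉ and let n_j be the orbit of 1 under T.  The sequence n_j (q/p)^j
-- increases and, because p ≥ 2q - 1, the sequence (n_j + 1)(q/p)^j decreases, so both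
-- converge to the same η, and η (p/q)^j lies in [n_j , n_j + 1].  The right end is never
-- reached: otherwise every power of q would divide n_j + 1.  Put ξ = η / q^k.  Then
-- ξ (p/q)^i = η (p/q)^(i+k) / p^k lies in [N/p^k , (N+1)/p^k) for N = T^k n_i.  Since
-- T^k (r + q^k w) = T^k r + p^k w, its fractional part lies in one of the q^k intervals
-- [T^k r / p^k , (T^k r + 1)/p^k) with r < q^k, and these have total length (q/p)^k.

open import Defs
open import Data.Integer using (+_)
open import Data.Nat as ℕ using (ℕ; NonZero)
open import Data.Nat.Coprimality using (Coprime)
open import Data.Product using (_×_; ∃-syntax)
open import Data.Rational as ℚ using ()
open import Relation.Unary using (_∈_; _⊆_; Satisfiable)

open import Algebra.Bundles using (CommutativeRing)
import Algebra.Properties.CommutativeSemigroup as CommutativeSemigroupProperties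
import Algebra.Properties.CommutativeSemiring.Exp as Exp
open import Data.Bool using (true; false)
import Data.Integer as ℤ
import Data.Integer.Properties as ℤₚ
open import Data.List using (List; applyUpTo)
open import Data.List.Relation.Unary.Any.Properties using (applyUpTo⁺; applyUpTo⁻)
open import Data.Nat using (zero; suc; _^_)
import Data.Nat.Coprimality as Coprimality
open import Data.Nat.Divisibility using (_∣_; divides; ∣⇒≤; ∣-trans; m∣m*n)
open import Data.Nat.DivMod using (m≡m%n+[m/n]*n; m%n<n; m/n*n≤m; +-distrib-/-∣ʳ; m*n/n≡m)
import Data.Nat.Properties as ℕₚ
import Data.Nat.Solver as ℕSolver
open import Data.Product using (_,_)
open import Data.Rational using (ℚ; 0ℚ; 1ℚ; mkℚ)
import Data.Rational.Properties as ℚₚ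
import Data.Rational.Solver as ℚSolver
import Data.Rational.Unnormalised as ℚᵘ
import Data.Rational.Unnormalised.Properties as ℚᵘₚ
open import Data.Sum using (_⊎_; inj₁; inj₂)
open import Relation.Binary.PropositionalEquality using (_≡_; refl; sym; trans; cong; cong₂; subst; subst₂; module ≡-Reasoning)

open Exp (CommutativeRing.commutativeSemiring ℚₚ.+-*-commutativeRing)
  using () renaming (^-homo-* to ^ℚ-homo-*; ^-distrib-* to ^ℚ-distrib-*)

open CommutativeSemigroupProperties ℕₚ.*-commutativeSemigroup using (x∙yz≈y∙xz; xy∙z≈y∙xz)

-- Powers of natural numbers

n<m^n : ∀ {m} → 2 ℕ.≤ m → ∀ n → n ℕ.< m ^ n
n<m^n     2≤m zero    = ℕ.s≤s ℕ.z≤n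
n<m^n {m} 2≤m (suc n) = let open ℕₚ.≤-Reasoning in begin
  suc (suc n)              ≤⟨ ℕ.s≤s (n<m^n 2≤m n) ⟩
  suc (m ^ n)              ≤⟨ ℕₚ.+-monoˡ-≤ (m ^ n) (ℕₚ.≤-trans (ℕ.s≤s ℕ.z≤n) (n<m^n 2≤m n)) ⟩
  m ^ n ℕ.+ m ^ n          ≡⟨ cong (m ^ n ℕ.+_) (sym (ℕₚ.+-identityʳ (m ^ n))) ⟩
  2 ℕ.* m ^ n              ≤⟨ ℕₚ.*-monoˡ-≤ (m ^ n) 2≤m ⟩
  m ^ suc n                ∎

-- A common divisor `d` of `m` and `n ^ suc j` is coprime to `n`, since every divisor of `d` divides
-- `m`. Euclid's lemma therefore strips one factor `n` at a time.
coprime-^ʳ : ∀ {m n} → Coprime m n → ∀ j → Coprime m (n ^ j)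
coprime-^ʳ         c zero    (_ , d∣1) = Coprimality.1-coprimeTo 1 (d∣1 , d∣1)
coprime-^ʳ {n = n} c (suc j) {d} (d∣m , d∣n^[1+j]) =
  coprime-^ʳ c j (d∣m , Coprimality.coprime-divisor d⊥n d∣n^[1+j])
  where
  d⊥n : Coprime d n
  d⊥n (e∣d , e∣n) = c (∣-trans e∣d d∣m , e∣n)

coprime-^ : ∀ {m n} → Coprime m n → ∀ i j → Coprime (m ^ i) (n ^ j)
coprime-^ c i j = coprime-^ʳ (Coprimality.sym (coprime-^ʳ (Coprimality.sym c) i)) j

-- This is (1 + 1/q)^j ≥ 1 + j/q, cleared of denominators by the factor q^(j+1).
bernoulli : ∀ q j → (q ℕ.+ j) ℕ.* q ^ j ℕ.≤ q ℕ.* suc q ^ j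
bernoulli q zero    = ℕₚ.≤-reflexive (cong (ℕ._* 1) (ℕₚ.+-identityʳ q))
bernoulli q (suc j) = let open ℕₚ.≤-Reasoning in begin
  (q ℕ.+ suc j) ℕ.* (q ℕ.* q ^ j)
    -- The added `j * q ^ j` completes the product (1 + q)(q + j)q^j.
    ≤⟨ ℕₚ.m≤m+n _ (j ℕ.* q ^ j) ⟩
  (q ℕ.+ suc j) ℕ.* (q ℕ.* q ^ j) ℕ.+ j ℕ.* q ^ j
    ≡⟨ solve 3 (λ q j x → (q :+ (con 1 :+ j)) :* (q :* x) :+ j :* x
                       := (con 1 :+ q) :* ((q :+ j) :* x)) refl q j (q ^ j) ⟩
  suc q ℕ.* ((q ℕ.+ j) ℕ.* q ^ j)
    ≤⟨ ℕₚ.*-monoʳ-≤ (suc q) (bernoulli q j) ⟩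
  suc q ℕ.* (q ℕ.* suc q ^ j)
    ≡⟨ x∙yz≈y∙xz (suc q) q (suc q ^ j) ⟩
  q ℕ.* suc q ^ suc j ∎
  where open ℕSolver.+-*-Solver

^-archimedean : ∀ {p q} .{{_ : NonZero q}} → q ℕ.< p → ∀ b → b ℕ.* q ^ (q ℕ.* b) ℕ.< p ^ (q ℕ.* b)
^-archimedean {p} {q} q<p b = let open ℕₚ.≤-Reasoning in begin
  suc (b ℕ.* q ^ j)       ≤⟨ ℕₚ.+-monoˡ-≤ (b ℕ.* q ^ j) (ℕₚ.m^n>0 q j) ⟩
  suc b ℕ.* q ^ j         ≤⟨ ℕₚ.*-cancelˡ-≤ q scaled ⟩
  suc q ^ j               ≤⟨ ℕₚ.^-monoˡ-≤ j q<p ⟩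
  p ^ j                   ∎
  where
  -- With this exponent the factor q + j in `bernoulli` becomes q(1 + b), so one `q` cancels.
  j = q ℕ.* b
  scaled : q ℕ.* (suc b ℕ.* q ^ j) ℕ.≤ q ℕ.* suc q ^ j
  scaled = subst (ℕ._≤ q ℕ.* suc q ^ j)
    (solve 3 (λ q b x → (q :+ q :* b) :* x := q :* ((con 1 :+ b) :* x)) refl q b (q ^ j))
    (bernoulli q j)
    where open ℕSolver.+-*-Solver

-- Natural numbers as rationals

ι : ℕ → ℚ
ι n = + n ℚ./ 1

private
  -- Elements of `ℚ` are kept in lowest terms, so identities with variable numerators do not hold by
  -- computation. This lemma moves them to unnormalised fractions, where they are cross-multiplied
  -- integer identities.
  toℚᵘ-/ : ∀ a b .{{_ : NonZero b}} → ℚ.toℚᵘ (+ a ℚ./ b) ℚᵘ.≃ + a ℚᵘ./ b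
  toℚᵘ-/ a (suc b) = ℚₚ.toℚᵘ-fromℚᵘ (ℚᵘ.mkℚᵘ (+ a) b)

ι-+ : ∀ m n → ι (m ℕ.+ n) ≡ ι m ℚ.+ ι n
ι-+ m n = ℚₚ.toℚᵘ-injective (let open ℚᵘₚ.≃-Reasoning in begin
  ℚ.toℚᵘ (ι (m ℕ.+ n))             ≈⟨ toℚᵘ-/ (m ℕ.+ n) 1 ⟩
  (+ (m ℕ.+ n)) ℚᵘ./ 1               ≈⟨ ℚᵘ.*≡* (cong (ℤ._* + 1) (cong₂ ℤ._+_ (sym (ℤₚ.*-identityʳ (+ m))) (sym (ℤₚ.*-identityʳ (+ n))))) ⟩
  (+ m ℚᵘ./ 1) ℚᵘ.+ (+ n ℚᵘ./ 1)       ≈⟨ ℚᵘₚ.+-cong (toℚᵘ-/ m 1) (toℚᵘ-/ n 1) ⟨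
  ℚ.toℚᵘ (ι m) ℚᵘ.+ ℚ.toℚᵘ (ι n)   ≈⟨ ℚₚ.toℚᵘ-homo-+ (ι m) (ι n) ⟨
  ℚ.toℚᵘ (ι m ℚ.+ ι n)             ∎)

/≡ι* : ∀ a b .{{_ : NonZero b}} → + a ℚ./ b ≡ ι a ℚ.* (+ 1 ℚ./ b)
/≡ι* a b@(suc _) = ℚₚ.toℚᵘ-injective (let open ℚᵘₚ.≃-Reasoning in begin
  ℚ.toℚᵘ (+ a ℚ./ b)                        ≈⟨ toℚᵘ-/ a b ⟩
  + a ℚᵘ./ b                                ≈⟨ ℚᵘ.*≡* (cong₂ ℤ._*_ (sym (ℤₚ.*-identityʳ (+ a))) (cong +_ (ℕₚ.+-identityʳ b))) ⟩
  (+ a ℚᵘ./ 1) ℚᵘ.* (+ 1 ℚᵘ./ b)                ≈⟨ ℚᵘₚ.*-cong (toℚᵘ-/ a 1) (toℚᵘ-/ 1 b) ⟨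
  ℚ.toℚᵘ (ι a) ℚᵘ.* ℚ.toℚᵘ (+ 1 ℚ./ b)      ≈⟨ ℚₚ.toℚᵘ-homo-* (ι a) (+ 1 ℚ./ b) ⟨
  ℚ.toℚᵘ (ι a ℚ.* (+ 1 ℚ./ b))              ∎)

ι-* : ∀ m n → ι (m ℕ.* n) ≡ ι m ℚ.* ι n
ι-* m n = ℚₚ.toℚᵘ-injective (let open ℚᵘₚ.≃-Reasoning in begin
  ℚ.toℚᵘ (ι (m ℕ.* n))             ≈⟨ toℚᵘ-/ (m ℕ.* n) 1 ⟩
  + (m ℕ.* n) ℚᵘ./ 1               ≈⟨ ℚᵘ.*≡* (cong (ℤ._* + 1) (ℤₚ.pos-* m n)) ⟩
  (+ m ℚᵘ./ 1) ℚᵘ.* (+ n ℚᵘ./ 1)       ≈⟨ ℚᵘₚ.*-cong (toℚᵘ-/ m 1) (toℚᵘ-/ n 1) ⟨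
  ℚ.toℚᵘ (ι m) ℚᵘ.* ℚ.toℚᵘ (ι n)   ≈⟨ ℚₚ.toℚᵘ-homo-* (ι m) (ι n) ⟨
  ℚ.toℚᵘ (ι m ℚ.* ι n)             ∎)

ι-*-1/ : ∀ b .{{_ : NonZero b}} → ι b ℚ.* (+ 1 ℚ./ b) ≡ 1ℚ
ι-*-1/ b@(suc _) = trans (sym (/≡ι* b b)) (ℚₚ.toℚᵘ-injective
  (ℚᵘₚ.≃-trans (toℚᵘ-/ b b) (ℚᵘ.*≡* (ℤₚ.*-comm (+ b) (+ 1)))))

ι-^ : ∀ m j → ι (m ^ j) ≡ ι m ^ℚ j
ι-^ m zero    = refl
ι-^ m (suc j) = trans (ι-* m (m ^ j)) (cong (ι m ℚ.*_) (ι-^ m j))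

ι-mono-≤ : ∀ {m n} → m ℕ.≤ n → ι m ℚ.≤ ι n
ι-mono-≤ {m} {n} m≤n = ℚₚ.toℚᵘ-cancel-≤
  (ℚᵘₚ.≤-respˡ-≃ (ℚᵘₚ.≃-sym (toℚᵘ-/ m 1)) (ℚᵘₚ.≤-respʳ-≃ (ℚᵘₚ.≃-sym (toℚᵘ-/ n 1))
    (ℚᵘ.*≤* (ℤₚ.*-monoʳ-≤-nonNeg (+ 1) (ℤ.+≤+ m≤n)))))

ι-mono-< : ∀ {m n} → m ℕ.< n → ι m ℚ.< ι n
ι-mono-< {m} {n} m<n = ℚₚ.toℚᵘ-cancel-<
  (ℚᵘₚ.<-respˡ-≃ (ℚᵘₚ.≃-sym (toℚᵘ-/ m 1)) (ℚᵘₚ.<-respʳ-≃ (ℚᵘₚ.≃-sym (toℚᵘ-/ n 1))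
    (ℚᵘ.*<* (ℤₚ.*-monoʳ-<-pos (+ 1) (ℤ.+<+ m<n)))))

ι-nonNeg : ∀ n → 0ℚ ℚ.≤ ι n
ι-nonNeg n = ι-mono-≤ (ℕ.z≤n {n})

1/-pos : ∀ b .{{_ : NonZero b}} → ℚ.Positive (+ 1 ℚ./ b)
1/-pos b = ℚₚ.normalize-pos 1 b

^ℚ-pos : ∀ x → ℚ.Positive x → ∀ j → ℚ.Positive (x ^ℚ j)
^ℚ-pos x x>0 zero    = _
^ℚ-pos x x>0 (suc j) = ℚₚ.pos*pos⇒pos x {{x>0}} (x ^ℚ j) {{^ℚ-pos x x>0 j}}

^ℚ-inverse : ∀ {x y} → x ℚ.* y ≡ 1ℚ → ∀ j → x ^ℚ j ℚ.* y ^ℚ j ≡ 1ℚ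
^ℚ-inverse {x} {y} xy≡1 j = trans (sym (^ℚ-distrib-* x y j)) (trans (cong (_^ℚ j) xy≡1) (1^ j))
  where
  1^ : ∀ j → 1ℚ ^ℚ j ≡ 1ℚ
  1^ zero    = refl
  1^ (suc j) = trans (ℚₚ.*-identityˡ (1ℚ ^ℚ j)) (1^ j)

archimedean : ∀ ε .{{_ : ℚ.Positive ε}} → ∃[ b ] 1ℚ ℚ.≤ ι b ℚ.* ε
-- Here `ε` is (n + 1)/(d + 1), so multiplying by its denominator leaves the integer n + 1 ≥ 1.
archimedean ε@(mkℚ ℤ.+[1+ n ] d _) = suc d , ℚₚ.toℚᵘ-cancel-≤
  (ℚᵘₚ.≤-respʳ-≃
    (ℚᵘₚ.≃-trans (ℚᵘₚ.*-congʳ (ℚᵘₚ.≃-sym (toℚᵘ-/ (suc d) 1)))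
      (ℚᵘₚ.≃-sym (ℚₚ.toℚᵘ-homo-* (ι (suc d)) ε)))
    (ℚᵘ.*≤* (ℤ.+≤+ (let open ℕₚ.≤-Reasoning in begin
      1 ℕ.* (1 ℕ.* suc d)            ≡⟨ trans (ℕₚ.*-identityˡ _) (ℕₚ.*-identityˡ (suc d)) ⟩
      suc d                          ≤⟨ ℕₚ.m≤m*n (suc d) (suc n) ⟩
      suc d ℕ.* suc n                ≡⟨ ℕₚ.*-identityʳ _ ⟨
      suc d ℕ.* suc n ℕ.* 1          ∎))))

∣-∣≤width : ∀ {a w x y} → a ℚ.≤ x → x ℚ.≤ a ℚ.+ w → a ℚ.≤ y → y ℚ.≤ a ℚ.+ w → ℚ.∣ x ℚ.- y ∣ ℚ.≤ w
∣-∣≤width {a} {w} {x} {y} a≤x x≤a+w a≤y y≤a+w = bound (ℚₚ.∣p∣≡p∨∣p∣≡-p (x ℚ.- y))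
  where
  open ℚSolver.+-*-Solver
  diff : ∀ {x y} → x ℚ.≤ a ℚ.+ w → a ℚ.≤ y → x ℚ.- y ℚ.≤ w
  diff x≤a+w a≤y = subst (_ ℚ.≤_) (solve 2 (λ a w → (a :+ w) :- a := w) refl a w)
    (ℚₚ.+-mono-≤ x≤a+w (ℚₚ.neg-antimono-≤ a≤y))
  bound : ℚ.∣ x ℚ.- y ∣ ≡ x ℚ.- y ⊎ ℚ.∣ x ℚ.- y ∣ ≡ ℚ.- (x ℚ.- y) → ℚ.∣ x ℚ.- y ∣ ℚ.≤ w
  bound (inj₁ eq) = subst (ℚ._≤ w) (sym eq) (diff x≤a+w a≤y)
  bound (inj₂ eq) = subst (ℚ._≤ w)
    (trans (solve 2 (λ x y → y :- x := :- (x :- y)) refl x y) (sym eq)) (diff y≤a+w a≤x)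

-- Reals with eventual rational bounds

p≤p+q : ∀ p {q} → 0ℚ ℚ.≤ q → p ℚ.≤ p ℚ.+ q
p≤p+q p {q} 0≤q = subst (ℚ._≤ p ℚ.+ q) (ℚₚ.+-identityʳ p) (ℚₚ.+-monoʳ-≤ p 0≤q)

fromℚ≤ : ∀ {a} x N → (∀ n → N ℕ.≤ n → a ℚ.≤ seq x n) → fromℚ a ≤ x
fromℚ≤ x N h ε 0<ε = N , λ n N≤n → ℚₚ.≤-trans (h n N≤n) (p≤p+q (seq x n) (ℚₚ.<⇒≤ 0<ε))

[_,_⟩ : ∀ a b → a ℚ.≤ b → Interval
[ a , b ⟩ a≤b = record
  { lower        = fromℚ a
  ; upper        = fromℚ b
  ; lower≤upper  = fromℚ≤ (fromℚ b) 0 λ _ _ → a≤b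
  ; lower-closed = true
  ; upper-closed = false
  }

[,⟩⊆[0,1⟩ : ∀ {a b} a≤b → 0ℚ ℚ.≤ a → b ℚ.≤ 1ℚ → ⟦ [ a , b ⟩ a≤b ⟧ ⊆ [0,1⟩
[,⟩⊆[0,1⟩ a≤b 0≤a b≤1 (a≤x , ε , 0<ε , N , x+ε≤b) =
  (λ δ 0<δ → let M , h = a≤x δ 0<δ in M , λ n M≤n → ℚₚ.≤-trans 0≤a (h n M≤n)) ,
  ε , 0<ε , N , λ n N≤n → ℚₚ.≤-trans (x+ε≤b n N≤n) b≤1

-- From index `N` on, `x` lies between a + w and b + w. The uniform gap `δ` at the right end is the
-- witness that a strict inequality between Cauchy sequences demands; it serves both the floor and
-- the half-open interval.
module _ {a b δ} (x : ℝ) (w N : ℕ) (0≤a : 0ℚ ℚ.≤ a) (b≤1 : b ℚ.≤ 1ℚ) (0<δ : 0ℚ ℚ.< δ)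
  (lo : ∀ n → N ℕ.≤ n → a ℚ.+ ι w ℚ.≤ seq x n)
  (hi : ∀ n → N ℕ.≤ n → seq x n ℚ.+ δ ℚ.≤ b ℚ.+ ι w) where

  isFloor : IsFloor x (+ w)
  isFloor =
    fromℚ≤ x N (λ n N≤n → ℚₚ.≤-trans
      (subst (ℚ._≤ a ℚ.+ ι w) (ℚₚ.+-identityˡ (ι w)) (ℚₚ.+-monoˡ-≤ (ι w) 0≤a)) (lo n N≤n)) ,
    δ , 0<δ , N , λ n N≤n → ℚₚ.≤-trans (hi n N≤n)
      (subst (b ℚ.+ ι w ℚ.≤_) (trans (ℚₚ.+-comm 1ℚ (ι w)) (sym (ι-+ w 1))) (ℚₚ.+-monoˡ-≤ (ι w) b≤1))

  frac∈[,⟩ : ∀ a≤b → x - fromℤ (+ w) ∈ ⟦ [ a , b ⟩ a≤b ⟧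
  frac∈[,⟩ _ =
    fromℚ≤ (x - fromℤ (+ w)) N (λ n N≤n →
      subst (ℚ._≤ seq x n ℚ.+ (ℚ.- 1ℚ) ℚ.* ι w) (cancel a (ι w)) (ℚₚ.+-monoˡ-≤ ((ℚ.- 1ℚ) ℚ.* ι w) (lo n N≤n))) ,
    δ , 0<δ , N , λ n N≤n →
      subst₂ ℚ._≤_ (swap (seq x n) δ (ι w)) (cancel b (ι w)) (ℚₚ.+-monoˡ-≤ ((ℚ.- 1ℚ) ℚ.* ι w) (hi n N≤n))
    where
    open ℚSolver.+-*-Solver
    cancel : ∀ a w → (a ℚ.+ w) ℚ.+ (ℚ.- 1ℚ) ℚ.* w ≡ a
    cancel = solve 2 (λ a w → (a :+ w) :+ con (ℚ.- 1ℚ) :* w := a) refl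
    swap : ∀ x d w → (x ℚ.+ d) ℚ.+ (ℚ.- 1ℚ) ℚ.* w ≡ (x ℚ.+ (ℚ.- 1ℚ) ℚ.* w) ℚ.+ d
    swap = solve 3 (λ x d w → (x :+ d) :+ con (ℚ.- 1ℚ) :* w := (x :+ con (ℚ.- 1ℚ) :* w) :+ d) refl

totalLength-applyUpTo : ∀ {c n} (J : ℕ → Interval) → (∀ r → seq (length (J r)) n ≡ c) →
  ∀ m → seq (totalLength (applyUpTo J m)) n ≡ ι m ℚ.* c
totalLength-applyUpTo {c} J h zero    = sym (ℚₚ.*-zeroˡ c)
totalLength-applyUpTo {c} {n} J h (suc m) = let open ≡-Reasoning in begin
  seq (length (J 0)) n ℚ.+ seq (totalLength (applyUpTo (λ r → J (suc r)) m)) n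
    ≡⟨ cong₂ ℚ._+_ (h 0) (totalLength-applyUpTo (λ r → J (suc r)) (λ r → h (suc r)) m) ⟩
  c ℚ.+ ι m ℚ.* c
    ≡⟨ cong (ℚ._+ ι m ℚ.* c) (ℚₚ.*-identityˡ c) ⟨
  1ℚ ℚ.* c ℚ.+ ι m ℚ.* c
    ≡⟨ ℚₚ.*-distribʳ-+ c 1ℚ (ι m) ⟨
  (1ℚ ℚ.+ ι m) ℚ.* c
    ≡⟨ cong (ℚ._* c) (ι-+ 1 m) ⟨
  ι (suc m) ℚ.* c ∎

-- The orbits of n ↦ ⌈pn/q⌉

module Orbit (p q : ℕ) .{{_ : NonZero p}} .{{_ : NonZero q}} (2≤q : 2 ℕ.≤ q) (q<p : q ℕ.< p)
  (p⊥q : Coprime p q) (2q≤1+p : 2 ℕ.* q ℕ.≤ suc p) where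

  T : ℕ → ℕ
  T n = (p ℕ.* n ℕ.+ ℕ.pred q) ℕ./ q

  T^ : ℕ → ℕ → ℕ
  T^ zero    n = n
  T^ (suc j) n = T^ j (T n)

  T^-+ : ∀ i j n → T^ (i ℕ.+ j) n ≡ T^ j (T^ i n)
  T^-+ zero    j n = refl
  T^-+ (suc i) j n = T^-+ i j (T n)

  -- The remainder modulo `q` is at most `pred q`, exactly what was added before dividing. With
  -- `qTn<pn+q` this pins `T n` down as the ceiling of pn/q.
  pn≤qTn : ∀ n → p ℕ.* n ℕ.≤ q ℕ.* T n
  pn≤qTn n = ℕₚ.+-cancelʳ-≤ (ℕ.pred q) (p ℕ.* n) (q ℕ.* T n) (let open ℕₚ.≤-Reasoning in begin
    p ℕ.* n ℕ.+ ℕ.pred q                  ≡⟨ m≡m%n+[m/n]*n (p ℕ.* n ℕ.+ ℕ.pred q) q ⟩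
    (p ℕ.* n ℕ.+ ℕ.pred q) ℕ.% q ℕ.+ T n ℕ.* q
      ≤⟨ ℕₚ.+-monoˡ-≤ (T n ℕ.* q) (ℕₚ.<⇒≤pred (m%n<n (p ℕ.* n ℕ.+ ℕ.pred q) q)) ⟩
    ℕ.pred q ℕ.+ T n ℕ.* q                ≡⟨ ℕₚ.+-comm (ℕ.pred q) (T n ℕ.* q) ⟩
    T n ℕ.* q ℕ.+ ℕ.pred q                ≡⟨ cong (ℕ._+ ℕ.pred q) (ℕₚ.*-comm (T n) q) ⟩
    q ℕ.* T n ℕ.+ ℕ.pred q                ∎)

  qTn<pn+q : ∀ n → q ℕ.* T n ℕ.< p ℕ.* n ℕ.+ q
  qTn<pn+q n = let open ℕₚ.≤-Reasoning in begin-strict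
    q ℕ.* T n                 ≡⟨ ℕₚ.*-comm q (T n) ⟩
    T n ℕ.* q                 ≤⟨ m/n*n≤m (p ℕ.* n ℕ.+ ℕ.pred q) q ⟩
    p ℕ.* n ℕ.+ ℕ.pred q      <⟨ ℕₚ.+-monoʳ-< (p ℕ.* n) (ℕₚ.≤-reflexive (ℕₚ.suc-pred q)) ⟩
    p ℕ.* n ℕ.+ q             ∎

  T-shift : ∀ n m → T (n ℕ.+ q ℕ.* m) ≡ T n ℕ.+ p ℕ.* m
  T-shift n m = let open ≡-Reasoning in begin
    (p ℕ.* (n ℕ.+ q ℕ.* m) ℕ.+ ℕ.pred q) ℕ./ q
      ≡⟨ cong (ℕ._/ q) (solve 5 (λ p q n m r → p :* (n :+ q :* m) :+ r := (p :* n :+ r) :+ (p :* m) :* q)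
                          refl p q n m (ℕ.pred q)) ⟩
    ((p ℕ.* n ℕ.+ ℕ.pred q) ℕ.+ (p ℕ.* m) ℕ.* q) ℕ./ q
      ≡⟨ +-distrib-/-∣ʳ (p ℕ.* n ℕ.+ ℕ.pred q) (divides (p ℕ.* m) refl) ⟩
    T n ℕ.+ (p ℕ.* m) ℕ.* q ℕ./ q
      ≡⟨ cong (T n ℕ.+_) (m*n/n≡m (p ℕ.* m) q) ⟩
    T n ℕ.+ p ℕ.* m ∎
    where open ℕSolver.+-*-Solver

  -- Each application of `T` trades one factor `q` of the shift for a factor `p`. Hence `T^ j`
  -- modulo p^j depends only on the argument modulo q^j.
  T^-shift : ∀ j n m → T^ j (n ℕ.+ q ^ j ℕ.* m) ≡ T^ j n ℕ.+ p ^ j ℕ.* m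
  T^-shift zero    n m = refl
  T^-shift (suc j) n m = let open ≡-Reasoning in begin
    T^ j (T (n ℕ.+ q ^ suc j ℕ.* m))        ≡⟨ cong (λ z → T^ j (T (n ℕ.+ z))) (ℕₚ.*-assoc q (q ^ j) m) ⟩
    T^ j (T (n ℕ.+ q ℕ.* (q ^ j ℕ.* m)))    ≡⟨ cong (T^ j) (T-shift n (q ^ j ℕ.* m)) ⟩
    T^ j (T n ℕ.+ p ℕ.* (q ^ j ℕ.* m))      ≡⟨ cong (λ z → T^ j (T n ℕ.+ z)) (x∙yz≈y∙xz p (q ^ j) m) ⟩
    T^ j (T n ℕ.+ q ^ j ℕ.* (p ℕ.* m))      ≡⟨ T^-shift j (T n) (p ℕ.* m) ⟩
    T^ j (T n) ℕ.+ p ^ j ℕ.* (p ℕ.* m)      ≡⟨ cong (T^ j (T n) ℕ.+_) (trans (x∙yz≈y∙xz (p ^ j) p m) (sym (ℕₚ.*-assoc p (p ^ j) m))) ⟩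
    T^ j (T n) ℕ.+ p ^ suc j ℕ.* m          ∎

  T-< : ∀ {n m} → n ℕ.< q ℕ.* m → T n ℕ.< p ℕ.* m
  T-< {n} {m} n<qm = ℕₚ.*-cancelˡ-< q (T n) (p ℕ.* m) (let open ℕₚ.≤-Reasoning in begin-strict
    q ℕ.* T n             <⟨ qTn<pn+q n ⟩
    -- Since q < p, the rounding error fits into one more multiple of `p`, and n + 1 ≤ qm.
    p ℕ.* n ℕ.+ q         ≤⟨ ℕₚ.+-monoʳ-≤ (p ℕ.* n) (ℕₚ.<⇒≤ q<p) ⟩
    p ℕ.* n ℕ.+ p         ≡⟨ trans (ℕₚ.+-comm (p ℕ.* n) p) (sym (ℕₚ.*-suc p n)) ⟩
    p ℕ.* suc n           ≤⟨ ℕₚ.*-monoʳ-≤ p n<qm ⟩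
    p ℕ.* (q ℕ.* m)       ≡⟨ x∙yz≈y∙xz p q m ⟩
    q ℕ.* (p ℕ.* m)       ∎)

  T^-< : ∀ j {n m} → n ℕ.< q ^ j ℕ.* m → T^ j n ℕ.< p ^ j ℕ.* m
  T^-< zero    n<m = n<m
  T^-< (suc j) {n} {m} n<q^m = subst (T^ j (T n) ℕ.<_) (sym (xy∙z≈y∙xz p (p ^ j) m))
    (T^-< j (subst (T n ℕ.<_) (x∙yz≈y∙xz p (q ^ j) m) (T-< (subst (n ℕ.<_) (ℕₚ.*-assoc q (q ^ j) m) n<q^m))))

  T^-lower : ∀ j n → p ^ j ℕ.* n ℕ.≤ q ^ j ℕ.* T^ j n
  T^-lower zero    n = ℕₚ.≤-refl
  T^-lower (suc j) n = let open ℕₚ.≤-Reasoning in begin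
    p ^ suc j ℕ.* n             ≡⟨ xy∙z≈y∙xz p (p ^ j) n ⟩
    p ^ j ℕ.* (p ℕ.* n)         ≤⟨ ℕₚ.*-monoʳ-≤ (p ^ j) (pn≤qTn n) ⟩
    p ^ j ℕ.* (q ℕ.* T n)       ≡⟨ x∙yz≈y∙xz (p ^ j) q (T n) ⟩
    q ℕ.* (p ^ j ℕ.* T n)       ≤⟨ ℕₚ.*-monoʳ-≤ q (T^-lower j (T n)) ⟩
    q ℕ.* (q ^ j ℕ.* T^ j (T n)) ≡⟨ ℕₚ.*-assoc q (q ^ j) _ ⟨
    q ^ suc j ℕ.* T^ j (T n)    ∎

  -- The only use of p ≥ 2q - 1.
  q[1+Tn]≤p[1+n] : ∀ n → q ℕ.* suc (T n) ℕ.≤ p ℕ.* suc n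
  q[1+Tn]≤p[1+n] n = ℕ.s≤s⁻¹ (let open ℕₚ.≤-Reasoning in begin
    suc (q ℕ.* suc (T n))       ≡⟨ cong suc (trans (ℕₚ.*-suc q (T n)) (ℕₚ.+-comm q (q ℕ.* T n))) ⟩
    -- Strictness of `qTn<pn+q` gains the unit that makes 2q ≤ p + 1 enough, where 2q ≤ p would
    -- otherwise be required.
    suc (q ℕ.* T n) ℕ.+ q       ≤⟨ ℕₚ.+-monoˡ-≤ q (qTn<pn+q n) ⟩
    p ℕ.* n ℕ.+ q ℕ.+ q         ≡⟨ solve 2 (λ a q → a :+ q :+ q := a :+ con 2 :* q) refl (p ℕ.* n) q ⟩
    p ℕ.* n ℕ.+ 2 ℕ.* q         ≤⟨ ℕₚ.+-monoʳ-≤ (p ℕ.* n) 2q≤1+p ⟩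
    p ℕ.* n ℕ.+ suc p           ≡⟨ solve 2 (λ p n → p :* n :+ (con 1 :+ p) := con 1 :+ p :* (con 1 :+ n)) refl p n ⟩
    suc (p ℕ.* suc n)           ∎)
    where open ℕSolver.+-*-Solver

  -- Iterating the one-step bound keeps (T^j n + 1)(q/p)^j at most n + 1; with `T^-lower`, the
  -- scaled orbit stays in [n, n + 1].
  T^-upper : ∀ j n → q ^ j ℕ.* suc (T^ j n) ℕ.≤ p ^ j ℕ.* suc n
  T^-upper zero    n = ℕₚ.≤-refl
  T^-upper (suc j) n = let open ℕₚ.≤-Reasoning in begin
    q ^ suc j ℕ.* suc (T^ j (T n))       ≡⟨ ℕₚ.*-assoc q (q ^ j) _ ⟩
    q ℕ.* (q ^ j ℕ.* suc (T^ j (T n)))   ≤⟨ ℕₚ.*-monoʳ-≤ q (T^-upper j (T n)) ⟩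
    q ℕ.* (p ^ j ℕ.* suc (T n))          ≡⟨ x∙yz≈y∙xz (p ^ j) q (suc (T n)) ⟨
    p ^ j ℕ.* (q ℕ.* suc (T n))          ≤⟨ ℕₚ.*-monoʳ-≤ (p ^ j) (q[1+Tn]≤p[1+n] n) ⟩
    p ^ j ℕ.* (p ℕ.* suc n)              ≡⟨ xy∙z≈y∙xz p (p ^ j) (suc n) ⟨
    p ^ suc j ℕ.* suc n                  ∎

  -- Equality would make q ^ (n+1) divide n+1.
  T^-upper-strict : ∀ n → q ^ suc n ℕ.* suc (T^ (suc n) n) ℕ.< p ^ suc n ℕ.* suc n
  T^-upper-strict n = ℕₚ.≤∧≢⇒< (T^-upper (suc n) n) λ eq →
    ℕₚ.<⇒≱ (n<m^n 2≤q (suc n)) (∣⇒≤ (Coprimality.coprime-divisor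
      (coprime-^ (Coprimality.sym p⊥q) (suc n) (suc n)) (subst (q ^ suc n ∣_) eq (m∣m*n (suc (T^ (suc n) n))))))

  -- The unit gained by strictness at step n + 1 is multiplied by `p` at each of the `e` later
  -- steps. Relative to p^(n+1+e) the gap therefore does not shrink.
  T^-upper-gap : ∀ n e → q ^ (suc n ℕ.+ e) ℕ.* suc (T^ (suc n ℕ.+ e) n) ℕ.+ p ^ e ℕ.≤ p ^ (suc n ℕ.+ e) ℕ.* suc n
  T^-upper-gap n e = let open ℕₚ.≤-Reasoning in begin
    q ^ (J ℕ.+ e) ℕ.* suc (T^ (J ℕ.+ e) n) ℕ.+ p ^ e
      ≡⟨ cong₂ (λ a b → a ℕ.* suc b ℕ.+ p ^ e) (ℕₚ.^-distribˡ-+-* q J e) (T^-+ J e n) ⟩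
    q ^ J ℕ.* q ^ e ℕ.* suc (T^ e (T^ J n)) ℕ.+ p ^ e
      ≡⟨ cong (ℕ._+ p ^ e) (ℕₚ.*-assoc (q ^ J) (q ^ e) _) ⟩
    q ^ J ℕ.* (q ^ e ℕ.* suc (T^ e (T^ J n))) ℕ.+ p ^ e
      ≤⟨ ℕₚ.+-monoˡ-≤ (p ^ e) (ℕₚ.*-monoʳ-≤ (q ^ J) (T^-upper e (T^ J n))) ⟩
    q ^ J ℕ.* (p ^ e ℕ.* suc (T^ J n)) ℕ.+ p ^ e
      ≡⟨ solve 3 (λ a b c → a :* (b :* c) :+ b := b :* (con 1 :+ a :* c)) refl (q ^ J) (p ^ e) (suc (T^ J n)) ⟩
    p ^ e ℕ.* suc (q ^ J ℕ.* suc (T^ J n))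
      ≤⟨ ℕₚ.*-monoʳ-≤ (p ^ e) (T^-upper-strict n) ⟩
    p ^ e ℕ.* (p ^ J ℕ.* suc n)
      ≡⟨ solve 3 (λ a b c → b :* (a :* c) := a :* b :* c) refl (p ^ J) (p ^ e) (suc n) ⟩
    p ^ J ℕ.* p ^ e ℕ.* suc n
      ≡⟨ cong (ℕ._* suc n) (ℕₚ.^-distribˡ-+-* p J e) ⟨
    p ^ (J ℕ.+ e) ℕ.* suc n ∎
    where
    J = suc n
    open ℕSolver.+-*-Solver

  -- Orbit bounds rescaled to rationals

  π κ ρ σ : ℚ
  π = + 1 ℚ./ p
  κ = + 1 ℚ./ q
  ρ = + q ℚ./ p
  σ = + p ℚ./ q

  πʲ-pos : ∀ j → ℚ.Positive (π ^ℚ j)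
  πʲ-pos = ^ℚ-pos π (1/-pos p)

  πʲ-nonNeg : ∀ j → ℚ.NonNegative (π ^ℚ j)
  πʲ-nonNeg j = ℚₚ.pos⇒nonNeg (π ^ℚ j) {{πʲ-pos j}}

  σρ≡1 : σ ℚ.* ρ ≡ 1ℚ
  σρ≡1 = let open ≡-Reasoning in begin
    σ ℚ.* ρ                            ≡⟨ cong₂ ℚ._*_ (/≡ι* p q) (/≡ι* q p) ⟩
    (ι p ℚ.* κ) ℚ.* (ι q ℚ.* π)        ≡⟨ solve 4 (λ a b c d → (a :* b) :* (c :* d) := (a :* d) :* (c :* b)) refl (ι p) κ (ι q) π ⟩
    (ι p ℚ.* π) ℚ.* (ι q ℚ.* κ)        ≡⟨ cong₂ ℚ._*_ (ι-*-1/ p) (ι-*-1/ q) ⟩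
    1ℚ ℚ.* 1ℚ                          ≡⟨⟩
    1ℚ                                 ∎
    where open ℚSolver.+-*-Solver

  κρ≡π : κ ℚ.* ρ ≡ π
  κρ≡π = let open ≡-Reasoning in begin
    κ ℚ.* ρ                 ≡⟨ cong (κ ℚ.*_) (/≡ι* q p) ⟩
    κ ℚ.* (ι q ℚ.* π)       ≡⟨ solve 3 (λ a b c → a :* (b :* c) := (b :* a) :* c) refl κ (ι q) π ⟩
    (ι q ℚ.* κ) ℚ.* π       ≡⟨ cong (ℚ._* π) (ι-*-1/ q) ⟩
    1ℚ ℚ.* π                ≡⟨ ℚₚ.*-identityˡ π ⟩
    π                       ∎
    where open ℚSolver.+-*-Solver

  ρʲ-nonNeg : ∀ j → ℚ.NonNegative (ρ ^ℚ j)
  ρʲ-nonNeg j = ℚₚ.pos⇒nonNeg (ρ ^ℚ j) {{^ℚ-pos ρ (ℚₚ.normalize-pos q p) j}}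

  ρʲ≡ : ∀ j → ρ ^ℚ j ≡ ι (q ^ j) ℚ.* π ^ℚ j
  ρʲ≡ j = let open ≡-Reasoning in begin
    ρ ^ℚ j                      ≡⟨ cong (_^ℚ j) (/≡ι* q p) ⟩
    (ι q ℚ.* π) ^ℚ j            ≡⟨ ^ℚ-distrib-* (ι q) π j ⟩
    ι q ^ℚ j ℚ.* π ^ℚ j         ≡⟨ cong (ℚ._* π ^ℚ j) (ι-^ q j) ⟨
    ι (q ^ j) ℚ.* π ^ℚ j        ∎

  ι[pʲ]*πʲ≡1 : ∀ j → ι (p ^ j) ℚ.* π ^ℚ j ≡ 1ℚ
  ι[pʲ]*πʲ≡1 j = trans (cong (ℚ._* π ^ℚ j) (ι-^ p j)) (^ℚ-inverse (ι-*-1/ p) j)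

  -- Together with `ι[pʲa]*πʲ`, this turns the integer orbit bounds into rational ones on
  -- multiplication by p^(-j).
  ι[qʲa]*πʲ : ∀ j a → ι (q ^ j ℕ.* a) ℚ.* π ^ℚ j ≡ ι a ℚ.* ρ ^ℚ j
  ι[qʲa]*πʲ j a = let open ≡-Reasoning in begin
    ι (q ^ j ℕ.* a) ℚ.* π ^ℚ j            ≡⟨ cong (λ z → ι z ℚ.* π ^ℚ j) (ℕₚ.*-comm (q ^ j) a) ⟩
    ι (a ℕ.* q ^ j) ℚ.* π ^ℚ j            ≡⟨ cong (ℚ._* π ^ℚ j) (ι-* a (q ^ j)) ⟩
    ι a ℚ.* ι (q ^ j) ℚ.* π ^ℚ j          ≡⟨ ℚₚ.*-assoc (ι a) (ι (q ^ j)) (π ^ℚ j) ⟩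
    ι a ℚ.* (ι (q ^ j) ℚ.* π ^ℚ j)        ≡⟨ cong (ι a ℚ.*_) (ρʲ≡ j) ⟨
    ι a ℚ.* ρ ^ℚ j                        ∎

  ι[pʲa]*πʲ : ∀ j a → ι (p ^ j ℕ.* a) ℚ.* π ^ℚ j ≡ ι a
  ι[pʲa]*πʲ j a = let open ≡-Reasoning in begin
    ι (p ^ j ℕ.* a) ℚ.* π ^ℚ j            ≡⟨ cong (λ z → ι z ℚ.* π ^ℚ j) (ℕₚ.*-comm (p ^ j) a) ⟩
    ι (a ℕ.* p ^ j) ℚ.* π ^ℚ j            ≡⟨ cong (ℚ._* π ^ℚ j) (ι-* a (p ^ j)) ⟩
    ι a ℚ.* ι (p ^ j) ℚ.* π ^ℚ j          ≡⟨ ℚₚ.*-assoc (ι a) (ι (p ^ j)) (π ^ℚ j) ⟩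
    ι a ℚ.* (ι (p ^ j) ℚ.* π ^ℚ j)        ≡⟨ cong (ι a ℚ.*_) (ι[pʲ]*πʲ≡1 j) ⟩
    ι a ℚ.* 1ℚ                            ≡⟨ ℚₚ.*-identityʳ (ι a) ⟩
    ι a                                   ∎

  *πʲ-mono : ∀ j {a b} → a ℕ.≤ b → ι a ℚ.* π ^ℚ j ℚ.≤ ι b ℚ.* π ^ℚ j
  *πʲ-mono j a≤b = ℚₚ.*-monoʳ-≤-nonNeg (π ^ℚ j) {{πʲ-nonNeg j}} (ι-mono-≤ a≤b)

  orbit-lower : ∀ j n → ι n ℚ.≤ ι (T^ j n) ℚ.* ρ ^ℚ j
  orbit-lower j n = subst₂ ℚ._≤_ (ι[pʲa]*πʲ j n) (ι[qʲa]*πʲ j (T^ j n)) (*πʲ-mono j (T^-lower j n))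

  orbit-upper : ∀ j n → ι (T^ j n) ℚ.* ρ ^ℚ j ℚ.≤ ι (suc n)
  orbit-upper j n = subst₂ ℚ._≤_ (ι[qʲa]*πʲ j (T^ j n)) (ι[pʲa]*πʲ j (suc n))
    (*πʲ-mono j (ℕₚ.≤-trans (ℕₚ.*-monoʳ-≤ (q ^ j) (ℕₚ.n≤1+n (T^ j n))) (T^-upper j n)))

  -- The gap p^e becomes p^(-(n+1)) after scaling, independently of `e`, so it survives the limit
  -- and keeps the right end from being reached.
  orbit-upper-gap : ∀ n e → ι (T^ (suc n ℕ.+ e) n) ℚ.* ρ ^ℚ (suc n ℕ.+ e) ℚ.+ π ^ℚ suc n ℚ.≤ ι (suc n)
  orbit-upper-gap n e = subst₂ ℚ._≤_ split (ι[pʲa]*πʲ j (suc n))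
    (*πʲ-mono j (ℕₚ.≤-trans (ℕₚ.+-monoˡ-≤ (p ^ e) (ℕₚ.*-monoʳ-≤ (q ^ j) (ℕₚ.n≤1+n (T^ j n)))) (T^-upper-gap n e)))
    where
    j = suc n ℕ.+ e
    π-part : ι (p ^ e) ℚ.* π ^ℚ j ≡ π ^ℚ suc n
    π-part = let open ≡-Reasoning in begin
      ι (p ^ e) ℚ.* π ^ℚ j                      ≡⟨ cong (ι (p ^ e) ℚ.*_) (^ℚ-homo-* π (suc n) e) ⟩
      ι (p ^ e) ℚ.* (π ^ℚ suc n ℚ.* π ^ℚ e)     ≡⟨ solve 3 (λ a b c → a :* (b :* c) := b :* (a :* c)) refl (ι (p ^ e)) (π ^ℚ suc n) (π ^ℚ e) ⟩
      π ^ℚ suc n ℚ.* (ι (p ^ e) ℚ.* π ^ℚ e)     ≡⟨ cong (π ^ℚ suc n ℚ.*_) (ι[pʲ]*πʲ≡1 e) ⟩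
      π ^ℚ suc n ℚ.* 1ℚ                         ≡⟨ ℚₚ.*-identityʳ (π ^ℚ suc n) ⟩
      π ^ℚ suc n                                ∎
      where open ℚSolver.+-*-Solver
    split : ι (q ^ j ℕ.* T^ j n ℕ.+ p ^ e) ℚ.* π ^ℚ j ≡ ι (T^ j n) ℚ.* ρ ^ℚ j ℚ.+ π ^ℚ suc n
    split = let open ≡-Reasoning in begin
      ι (q ^ j ℕ.* T^ j n ℕ.+ p ^ e) ℚ.* π ^ℚ j
        ≡⟨ cong (ℚ._* π ^ℚ j) (ι-+ (q ^ j ℕ.* T^ j n) (p ^ e)) ⟩
      (ι (q ^ j ℕ.* T^ j n) ℚ.+ ι (p ^ e)) ℚ.* π ^ℚ j
        ≡⟨ ℚₚ.*-distribʳ-+ (π ^ℚ j) (ι (q ^ j ℕ.* T^ j n)) (ι (p ^ e)) ⟩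
      ι (q ^ j ℕ.* T^ j n) ℚ.* π ^ℚ j ℚ.+ ι (p ^ e) ℚ.* π ^ℚ j
        ≡⟨ cong₂ ℚ._+_ (ι[qʲa]*πʲ j (T^ j n)) π-part ⟩
      ι (T^ j n) ℚ.* ρ ^ℚ j ℚ.+ π ^ℚ suc n ∎

  ρʲ→0 : ∀ ε → 0ℚ ℚ.< ε → ∃[ j ] ρ ^ℚ j ℚ.< ε
  ρʲ→0 ε 0<ε with archimedean ε {{ℚ.positive 0<ε}}
  -- The chain is bρ^j < 1 ≤ bε, with `b` cancelled; its first inequality is `^-archimedean` divided
  -- by p^j.
  ... | b , 1≤bε = j , ℚₚ.*-cancelˡ-<-nonNeg (ι b) {{ℚ.nonNegative (ι-nonNeg b)}} (ℚₚ.<-≤-trans bρʲ<1 1≤bε)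
    where
    j = q ℕ.* b
    bρʲ<1 : ι b ℚ.* ρ ^ℚ j ℚ.< 1ℚ
    bρʲ<1 = subst₂ ℚ._<_
      (trans (cong (λ z → ι z ℚ.* π ^ℚ j) (ℕₚ.*-comm b (q ^ j))) (ι[qʲa]*πʲ j b)) (ι[pʲ]*πʲ≡1 j)
      (ℚₚ.*-monoˡ-<-pos (π ^ℚ j) {{πʲ-pos j}} (ι-mono-< (^-archimedean q<p b)))

  -- The limit of the scaled orbit of 1

  approx : ℕ → ℚ
  approx j = ι (T^ j 1) ℚ.* ρ ^ℚ j

  -- Restarting the orbit at `T^ i 1` lets the bounds for an arbitrary starting point control the
  -- tail, up to the factor `ρ ^ℚ i`.
  approx-+ : ∀ i j → approx (i ℕ.+ j) ≡ ι (T^ j (T^ i 1)) ℚ.* ρ ^ℚ j ℚ.* ρ ^ℚ i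
  approx-+ i j = trans (cong₂ (λ a b → ι a ℚ.* b) (T^-+ i j 1) (^ℚ-homo-* ρ i j))
    (solve 3 (λ a b c → a :* (b :* c) := a :* c :* b) refl (ι (T^ j (T^ i 1))) (ρ ^ℚ i) (ρ ^ℚ j))
    where open ℚSolver.+-*-Solver

  approx-lower : ∀ {i m} → i ℕ.≤ m → approx i ℚ.≤ approx m
  approx-lower {i} i≤m with ℕₚ.m≤n⇒∃[o]m+o≡n i≤m
  ... | j , refl = subst (approx i ℚ.≤_) (sym (approx-+ i j))
    (ℚₚ.*-monoʳ-≤-nonNeg (ρ ^ℚ i) {{ρʲ-nonNeg i}} (orbit-lower j (T^ i 1)))

  approx-upper : ∀ {i m} → i ℕ.≤ m → approx m ℚ.≤ approx i ℚ.+ ρ ^ℚ i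
  approx-upper {i} i≤m with ℕₚ.m≤n⇒∃[o]m+o≡n i≤m
  ... | j , refl = subst₂ ℚ._≤_ (sym (approx-+ i j)) distrib
    (ℚₚ.*-monoʳ-≤-nonNeg (ρ ^ℚ i) {{ρʲ-nonNeg i}} (orbit-upper j (T^ i 1)))
    where
    open ℚSolver.+-*-Solver
    distrib : ι (suc (T^ i 1)) ℚ.* ρ ^ℚ i ≡ approx i ℚ.+ ρ ^ℚ i
    distrib = trans (cong (ℚ._* ρ ^ℚ i) (ι-+ 1 (T^ i 1)))
      (solve 2 (λ a b → (con 1ℚ :+ a) :* b := a :* b :+ b) refl (ι (T^ i 1)) (ρ ^ℚ i))

  -- All terms from index `N` on lie in one interval of width `ρ ^ℚ N`, and these widths tend to 0.
  approx-cauchy : IsCauchy approx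
  approx-cauchy ε 0<ε with ρʲ→0 ε 0<ε
  ... | N , ρᴺ<ε = N , λ m n N≤m N≤n → ℚₚ.≤-<-trans
    (∣-∣≤width (approx-lower N≤m) (approx-upper N≤m) (approx-lower N≤n) (approx-upper N≤n)) ρᴺ<ε

  η : ℝ
  η = mkℝ approx approx-cauchy

  -- The intervals and the fractional parts of ξ(p/q)^i

  module _ (k : ℕ) where

    ξ : ℝ
    ξ = (κ ^ℚ k) · η

    lo hi : ℕ → ℚ
    lo N = ι N ℚ.* π ^ℚ k
    hi N = ι (suc N) ℚ.* π ^ℚ k

    lo≤hi : ∀ N → lo N ℚ.≤ hi N
    lo≤hi N = *πʲ-mono k (ℕₚ.n≤1+n N)

    J : ℕ → Interval
    J r = [ lo (T^ k r) , hi (T^ k r) ⟩ (lo≤hi (T^ k r))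

    Js : List Interval
    Js = applyUpTo J (q ^ k)

    0≤lo : ∀ N → 0ℚ ℚ.≤ lo N
    0≤lo N = subst (ℚ._≤ lo N) (ℚₚ.*-zeroˡ (π ^ℚ k)) (*πʲ-mono k (ℕ.z≤n {N}))

    hi≤1 : ∀ {r} → r ℕ.< q ^ k → hi (T^ k r) ℚ.≤ 1ℚ
    -- Taking m = 1 in `T^-<` gives T^k r < p^k, that is, T^k r + 1 ≤ p^k, as the right end
    -- requires.
    hi≤1 {r} r<qᵏ = subst (hi (T^ k r) ℚ.≤_) (ι[pʲ]*πʲ≡1 k) (*πʲ-mono k
      (subst (T^ k r ℕ.<_) (ℕₚ.*-identityʳ (p ^ k))
        (T^-< k (subst (r ℕ.<_) (sym (ℕₚ.*-identityʳ (q ^ k))) r<qᵏ))))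

    Js⊆[0,1⟩ : ⋃ Js ⊆ [0,1⟩
    Js⊆[0,1⟩ {x} x∈ with applyUpTo⁻ J x∈
    ... | r , r<qᵏ , x∈J = [,⟩⊆[0,1⟩ (lo≤hi (T^ k r)) (0≤lo (T^ k r)) (hi≤1 r<qᵏ) {x} x∈J

    length-J : ∀ r → hi (T^ k r) ℚ.+ (ℚ.- 1ℚ) ℚ.* lo (T^ k r) ≡ π ^ℚ k
    length-J r = trans (cong (λ z → z ℚ.* π ^ℚ k ℚ.+ (ℚ.- 1ℚ) ℚ.* lo (T^ k r)) (ι-+ 1 (T^ k r)))
      (solve 2 (λ a b → (con 1ℚ :+ a) :* b :+ con (ℚ.- 1ℚ) :* (a :* b) := b) refl (ι (T^ k r)) (π ^ℚ k))
      where open ℚSolver.+-*-Solver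

    totalLength-Js : totalLength Js ≤ fromℚ (ρ ^ℚ k)
    totalLength-Js ε 0<ε = 0 , λ n _ → subst (ℚ._≤ ρ ^ℚ k ℚ.+ ε)
      (trans (ρʲ≡ k) (sym (totalLength-applyUpTo {n = n} J length-J (q ^ k))))
      (p≤p+q (ρ ^ℚ k) (ℚₚ.<⇒≤ 0<ε))

    κᵏ-pos : ℚ.Positive (κ ^ℚ k)
    κᵏ-pos = ^ℚ-pos κ (1/-pos q) k

    0<ξ : 0ℝ < ξ
    -- `approx` never drops below `approx 0`, which computes to 1, so q^(-k) bounds every term of
    -- `ξ` from below.
    0<ξ = κ ^ℚ k , ℚₚ.positive⁻¹ (κ ^ℚ k) {{κᵏ-pos}} , 0 , λ n _ →
      subst₂ ℚ._≤_ (trans (ℚₚ.*-identityʳ (κ ^ℚ k)) (sym (ℚₚ.+-identityˡ (κ ^ℚ k)))) refl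
        (ℚₚ.*-monoˡ-≤-nonNeg (κ ^ℚ k) {{ℚₚ.pos⇒nonNeg (κ ^ℚ k) {{κᵏ-pos}}}} (approx-lower {0} {n} ℕ.z≤n))

    -- The factor (p/q)^i cancels `ρ ^ℚ i`, and q^(-k) turns `ρ ^ℚ k` into p^(-k). What remains is
    -- the scaled orbit started at `T^ (i + k) 1`, divided by p^k.
    seq-σⁱξ : ∀ i j → seq ((σ ^ℚ i) · ξ) (i ℕ.+ k ℕ.+ j) ≡ ι (T^ j (T^ (i ℕ.+ k) 1)) ℚ.* ρ ^ℚ j ℚ.* π ^ℚ k
    seq-σⁱξ i j = let open ≡-Reasoning in begin
      σ ^ℚ i ℚ.* (κ ^ℚ k ℚ.* approx (i ℕ.+ k ℕ.+ j))
        ≡⟨ cong (λ z → σ ^ℚ i ℚ.* (κ ^ℚ k ℚ.* z)) (trans (approx-+ (i ℕ.+ k) j) (cong (x ℚ.*_) (^ℚ-homo-* ρ i k))) ⟩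
      σ ^ℚ i ℚ.* (κ ^ℚ k ℚ.* (x ℚ.* (ρ ^ℚ i ℚ.* ρ ^ℚ k)))
        ≡⟨ solve 5 (λ s k x r t → s :* (k :* (x :* (r :* t))) := (s :* r) :* (x :* (k :* t))) refl
             (σ ^ℚ i) (κ ^ℚ k) x (ρ ^ℚ i) (ρ ^ℚ k) ⟩
      (σ ^ℚ i ℚ.* ρ ^ℚ i) ℚ.* (x ℚ.* (κ ^ℚ k ℚ.* ρ ^ℚ k))
        ≡⟨ cong₂ (λ a b → a ℚ.* (x ℚ.* b)) (^ℚ-inverse σρ≡1 i)
             (trans (sym (^ℚ-distrib-* κ ρ k)) (cong (_^ℚ k) κρ≡π)) ⟩
      1ℚ ℚ.* (x ℚ.* π ^ℚ k)
        ≡⟨ ℚₚ.*-identityˡ (x ℚ.* π ^ℚ k) ⟩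
      x ℚ.* π ^ℚ k ∎
      where
      open ℚSolver.+-*-Solver
      x = ι (T^ j (T^ (i ℕ.+ k) 1)) ℚ.* ρ ^ℚ j

    shift-πᵏ : ∀ m w → ι (m ℕ.+ p ^ k ℕ.* w) ℚ.* π ^ℚ k ≡ ι m ℚ.* π ^ℚ k ℚ.+ ι w
    shift-πᵏ m w = let open ≡-Reasoning in begin
      ι (m ℕ.+ p ^ k ℕ.* w) ℚ.* π ^ℚ k                        ≡⟨ cong (ℚ._* π ^ℚ k) (ι-+ m (p ^ k ℕ.* w)) ⟩
      (ι m ℚ.+ ι (p ^ k ℕ.* w)) ℚ.* π ^ℚ k                    ≡⟨ ℚₚ.*-distribʳ-+ (π ^ℚ k) (ι m) (ι (p ^ k ℕ.* w)) ⟩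
      ι m ℚ.* π ^ℚ k ℚ.+ ι (p ^ k ℕ.* w) ℚ.* π ^ℚ k           ≡⟨ cong (ι m ℚ.* π ^ℚ k ℚ.+_) (ι[pʲa]*πʲ k w) ⟩
      ι m ℚ.* π ^ℚ k ℚ.+ ι w                                  ∎

    frac∈Js : ∀ i → FracIn (⋃ Js) ((σ ^ℚ i) · ξ)
    frac∈Js i = + w
      , isFloor x w N 0≤a b≤1 0<δ lower-bound upper-bound
      , applyUpTo⁺ J (frac∈[,⟩ x w N 0≤a b≤1 0<δ lower-bound upper-bound (lo≤hi (T^ k r))) r<qᵏ
      where
      instance
        qᵏ≢0 : NonZero (q ^ k)
        qᵏ≢0 = ℕₚ.m^n≢0 q k
      x = (σ ^ℚ i) · ξ
      -- Division of the orbit point `T^ i 1` by q^k yields the index `r` of the interval and the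
      -- floor `w`. The bound `N` waits n + 1 steps past i + k, because `orbit-upper-gap` starts
      -- only there.
      r w n N : ℕ
      r = T^ i 1 ℕ.% q ^ k
      w = T^ i 1 ℕ./ q ^ k
      n = T^ (i ℕ.+ k) 1
      N = i ℕ.+ k ℕ.+ suc n
      δ : ℚ
      -- This is the gap of `orbit-upper-gap`, divided by p^k.
      δ = π ^ℚ suc n ℚ.* π ^ℚ k
      0≤a = 0≤lo (T^ k r)
      r<qᵏ : r ℕ.< q ^ k
      r<qᵏ = m%n<n (T^ i 1) (q ^ k)
      b≤1 : hi (T^ k r) ℚ.≤ 1ℚ
      b≤1 = hi≤1 r<qᵏ
      0<δ : 0ℚ ℚ.< δ
      0<δ = ℚₚ.positive⁻¹ δ {{ℚₚ.pos*pos⇒pos (π ^ℚ suc n) {{πʲ-pos (suc n)}} (π ^ℚ k) {{πʲ-pos k}}}}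
      n≡ : n ≡ T^ k r ℕ.+ p ^ k ℕ.* w
      n≡ = let open ≡-Reasoning in begin
        T^ (i ℕ.+ k) 1                    ≡⟨ T^-+ i k 1 ⟩
        T^ k (T^ i 1)                     ≡⟨ cong (T^ k) (m≡m%n+[m/n]*n (T^ i 1) (q ^ k)) ⟩
        T^ k (r ℕ.+ w ℕ.* q ^ k)          ≡⟨ cong (λ z → T^ k (r ℕ.+ z)) (ℕₚ.*-comm w (q ^ k)) ⟩
        T^ k (r ℕ.+ q ^ k ℕ.* w)          ≡⟨ T^-shift k r w ⟩
        T^ k r ℕ.+ p ^ k ℕ.* w            ∎
      lower-bound : ∀ m → N ℕ.≤ m → lo (T^ k r) ℚ.+ ι w ℚ.≤ seq x m
      -- The lower bound holds from i + k on, so the extra n + 1 steps are dropped.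
      lower-bound m N≤m with ℕₚ.m≤n⇒∃[o]m+o≡n (ℕₚ.≤-trans (ℕₚ.m≤m+n (i ℕ.+ k) (suc n)) N≤m)
      ... | j , refl = subst₂ ℚ._≤_
        (trans (cong (λ z → ι z ℚ.* π ^ℚ k) n≡) (shift-πᵏ (T^ k r) w)) (sym (seq-σⁱξ i j))
        (ℚₚ.*-monoʳ-≤-nonNeg (π ^ℚ k) {{πʲ-nonNeg k}} (orbit-lower j n))
      upper-bound : ∀ m → N ℕ.≤ m → seq x m ℚ.+ δ ℚ.≤ hi (T^ k r) ℚ.+ ι w
      upper-bound m N≤m with ℕₚ.m≤n⇒∃[o]m+o≡n N≤m
      ... | e , refl = subst₂ ℚ._≤_
        (trans (ℚₚ.*-distribʳ-+ (π ^ℚ k) (ι (T^ j n) ℚ.* ρ ^ℚ j) (π ^ℚ suc n))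
          (cong (ℚ._+ δ) (trans (sym (seq-σⁱξ i j)) (cong (seq x) (sym (ℕₚ.+-assoc (i ℕ.+ k) (suc n) e))))))
        (trans (cong (λ z → ι (suc z) ℚ.* π ^ℚ k) n≡) (shift-πᵏ (suc (T^ k r)) w))
        (ℚₚ.*-monoʳ-≤-nonNeg (π ^ℚ k) {{πʲ-nonNeg k}} (orbit-upper-gap n e))
        where j = suc n ℕ.+ e

theorem2 : (p q : ℕ) .{{_ : NonZero p}} .{{_ : NonZero q}} →
    2 ℕ.≤ q → q ℕ.< p → Coprime p q → 2 ℕ.* q ℕ.∸ 1 ℕ.≤ p →
    (k : ℕ) → 0 ℕ.< k →
    ∃[ Js ] (⋃ Js ⊆ [0,1⟩
    × totalLength Js ≤ fromℚ ((+ q ℚ./ p) ^ℚ k)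
    × Satisfiable (Z p q (⋃ Js)))
theorem2 p q 2≤q q<p p⊥q 2q-1≤p k _ = Js k , (λ {x} → Js⊆[0,1⟩ k {x}) , totalLength-Js k , ξ k , 0<ξ k , frac∈Js k
  where
  -- The hypothesis with truncated subtraction becomes 2q ≤ 1 + (2q ∸ 1) ≤ 1 + p.
  open Orbit p q 2≤q q<p p⊥q (ℕₚ.≤-trans (ℕₚ.m≤n+m∸n (2 ℕ.* q) 1) (ℕ.s≤s 2q-1≤p))
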